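{- For a finite tree $T$ on $n = |V(T)|$ vertices, let $$s_{10}(T) = R(T) + \alpha(T) - n + 1 - \sqrt{n-1},$$ where $R(T) = \sum_{uv \in E(T)} \frac{1}{\sqrt{d_u d_v}}$ is the Randić index of $T$ and $\alpha(T)$ is the independence number of $T$. For each positive integer $b$, let $T(2,b)$ be the tree on $2b+1$ vertices with vertex set $\{u_1, \dots, u_b\} \cup \{v\} \cup \{w_1, \dots, w_b\}$ and edge set $\{u_1u_2, \dots, u_1u_b\} \cup \{u_1v, vw_1\} \cup \{w_1w_2, \dots, w_1w_b\}$. Then $$\lim_{b \to \infty} s_{10}(T(2,b)) = \infty.$$
   Context: Graphs are finite, simple and undirected; $V(G)$ and $E(G)$ denote the vertex and edge sets of $G$, an edge $\{u,v\}$ is written $uv$, and $d_v$ denotes the degree of the vertex $v$. The independence number $\alpha(G)$ is the maximum size of a set of pairwise nonadjacent vertices of $G$. In the definition of $T(2,b)$ the $2b+1$ named vertices are pairwise distinct; $T(2,b)$ is the tree obtained by joining the centers of two copies of the star on $b$ vertices to a new vertex $v$. -}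

module Defs where

open import Data.Bool using (true; false)
open import Data.Empty using (⊥)
open import Data.Fin as Fin using (Fin; zero; suc; splitAt)
import Data.Fin.Properties as Fin
open import Data.Fin.Subset using (Subset; _∈_; ∣_∣; inside; outside)
open import Data.Fin.Subset.Properties using (_∈?_; ∣⊥∣≡0; ∉⊥)
open import Data.Integer as ℤ using (+_; -[1+_])
import Data.Integer.Properties as ℤ
open import Data.List using (List; []; _∷_; _++_; _∷ʳ_; map; filter; foldr; length; allFin; cartesianProduct)
open import Data.List.Extrema.Nat using (max; xs≤max; argmax-sel)
import Data.List.Membership.Propositional as List
open import Data.List.Membership.Propositional.Properties
  using (∈-map⁺; ∈-map⁻; ∈-filter⁺; ∈-filter⁻; ∈-++⁺ˡ; ∈-++⁺ʳ; ∈-allFin)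
open import Data.List.Relation.Unary.All as All using (All; []; _∷_)
open import Data.List.Relation.Unary.AllPairs using ([]; _∷_)
open import Data.List.Relation.Unary.Any using (here; there)
open import Data.List.Relation.Unary.Linked using (Linked; []; [-]; _∷_)
open import Data.List.Relation.Unary.Unique.Propositional using (Unique)
open import Data.Nat as ℕ using (ℕ; zero; suc; NonZero)
import Data.Nat.Properties as ℕ
open import Data.Product using (∃; ∃-syntax; _×_; _,_; proj₁; proj₂)
open import Data.Rational as ℚ using (ℚ; mkℚ; 0ℚ; 1ℚ; toℚᵘ)
import Data.Rational.Properties as ℚ
open import Data.Rational.Solver using (module +-*-Solver)
import Data.Rational.Unnormalised as ℚᵘ
import Data.Rational.Unnormalised.Properties as ℚᵘ
open import Data.Sum as Sum using (_⊎_; inj₁; inj₂)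
open import Data.Vec using ([]; _∷_)
open import Function using (_∘_; _on_)
open import Relation.Binary using (Rel; Decidable; Symmetric; Irreflexive; tri<; tri≈; tri>)
open import Relation.Binary.Construct.Closure.ReflexiveTransitive using (Star; ε; _◅_; _◅◅_; reverse)
open import Relation.Binary.Construct.Closure.Symmetric using (SymClosure; fwd; bwd; symmetric)
open import Relation.Binary.PropositionalEquality
  using (_≡_; _≢_; refl; sym; trans; cong; subst; subst₂)
open import Relation.Nullary using (¬_; Dec; yes; no; contradiction)
open import Relation.Nullary.Decidable using (_×-dec_; _→-dec_; ¬?)
open import Relation.Unary using (Pred)
open import Level using (0ℓ)

record ℝ : Set₁ where
  field
    L U         : Pred ℚ 0ℓ
    L-inhabited : ∃ L
    U-inhabited : ∃ U
    L-lower     : ∀ {p q} → p ℚ.< q → L q → L p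
    U-upper     : ∀ {p q} → p ℚ.< q → U p → U q
    L-open      : ∀ {p} → L p → ∃[ q ] p ℚ.< q × L q
    U-open      : ∀ {q} → U q → ∃[ p ] p ℚ.< q × U p
    disjoint    : ∀ {q} → L q → U q → ⊥
    located     : ∀ {p q} → p ℚ.< q → L p ⊎ U q

open ℝ

infix 4 _<_

_<_ : ℝ → ℝ → Set
x < y = ∃[ q ] U x q × L y q

L<U : ∀ x {p q} → L x p → U x q → p ℚ.< q
L<U x {p} {q} l u with ℚ.<-cmp p q
... | tri< p<q _ _ = p<q
... | tri≈ _ refl _ = contradiction u (disjoint x l)
... | tri> _ _ q<p = contradiction u (disjoint x (L-lower x q<p l))

private module S = +-*-Solver
open S using (_:+_; _:*_; _:-_; :-_; _:=_; con)

neg-involutive : ∀ p → ℚ.- ℚ.- p ≡ p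
neg-involutive = S.solve 1 (λ p → :- (:- p) := p) refl

p-1<p : ∀ p → p ℚ.- 1ℚ ℚ.< p
p-1<p p = subst (p ℚ.- 1ℚ ℚ.<_) (ℚ.+-identityʳ p) (ℚ.+-monoʳ-< p (ℚ.negative⁻¹ (ℚ.- 1ℚ)))

p<p+1 : ∀ p → p ℚ.< p ℚ.+ 1ℚ
p<p+1 p = subst (ℚ._< p ℚ.+ 1ℚ) (ℚ.+-identityʳ p) (ℚ.+-monoʳ-< p (ℚ.positive⁻¹ 1ℚ))

0<q-p : ∀ {p q} → p ℚ.< q → 0ℚ ℚ.< q ℚ.- p
0<q-p {p} {q} p<q = subst (ℚ._< q ℚ.- p) (ℚ.+-inverseʳ p) (ℚ.+-monoˡ-< (ℚ.- p) p<q)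

fromℚ : ℚ → ℝ
fromℚ r = record
  { L = ℚ._< r
  ; U = r ℚ.<_
  ; L-inhabited = r ℚ.- 1ℚ , p-1<p r
  ; U-inhabited = r ℚ.+ 1ℚ , p<p+1 r
  ; L-lower = ℚ.<-trans
  ; U-upper = λ p<q r<p → ℚ.<-trans r<p p<q
  ; L-open = ℚ.<-dense
  ; U-open = λ r<q → let (m , r<m , m<q) = ℚ.<-dense r<q in m , m<q , r<m
  ; disjoint = ℚ.<-asym
  ; located = loc
  }
  where
  loc : ∀ {p q} → p ℚ.< q → p ℚ.< r ⊎ r ℚ.< q
  loc {p} p<q with p ℚ.<? r
  ... | yes p<r = inj₁ p<r
  ... | no p≮r = inj₂ (ℚ.≤-<-trans (ℚ.≮⇒≥ p≮r) p<q)

ℕ→ℚ : ℕ → ℚ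
ℕ→ℚ m = + m ℚ./ 1

fromℕ : ℕ → ℝ
fromℕ m = fromℚ (ℕ→ℚ m)

ι : ℕ → ℚ
ι zero = 0ℚ
ι (suc k) = 1ℚ ℚ.+ ι k

toℚᵘ-ι : ∀ k → toℚᵘ (ι k) ℚᵘ.≃ ℚᵘ.mkℚᵘ (+ k) 0
toℚᵘ-ι zero = ℚᵘ.≃-refl
toℚᵘ-ι (suc k) = ℚᵘ.≃-trans (ℚ.toℚᵘ-homo-+ 1ℚ (ι k))
  (ℚᵘ.≃-trans (ℚᵘ.+-cong (ℚᵘ.≃-refl {ℚᵘ.1ℚᵘ}) (toℚᵘ-ι k)) (ℚᵘ.*≡* (cong (λ z → (ℤ.1ℤ ℤ.+ z) ℤ.* ℤ.1ℤ) (ℤ.*-identityʳ (+ k)))))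

archimedean : ∀ t → ∃[ N ] t ℚ.< ι N
archimedean t = suc (k t) ,
  ℚ.≤-<-trans (t≤ t) (subst (ℚ._< 1ℚ ℚ.+ ι (k t)) (ℚ.+-identityˡ _)
    (ℚ.+-monoˡ-< (ι (k t)) (ℚ.positive⁻¹ 1ℚ)))
  where
  k : ℚ → ℕ
  k t = ℤ.∣ ℚ.↥ t ∣
  core : ∀ n d → n ℤ.* ℤ.1ℤ ℤ.≤ + ℤ.∣ n ∣ ℤ.* + suc d
  core n d = ℤ.≤-trans (ℤ.≤-reflexive (ℤ.*-identityʳ n)) (ℤ.≤-trans (i≤ n)
    (subst (ℤ._≤_ _) (ℤ.pos-* ℤ.∣ n ∣ (suc d)) (ℤ.+≤+ (ℕ.m≤m*n ℤ.∣ n ∣ (suc d)))))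
    where
    i≤ : ∀ i → i ℤ.≤ + ℤ.∣ i ∣
    i≤ (+ _) = ℤ.≤-refl
    i≤ -[1+ _ ] = ℤ.-≤+
  t≤ : ∀ t → t ℚ.≤ ι (k t)
  t≤ t@(mkℚ n d _) = ℚ.toℚᵘ-cancel-≤
    (ℚᵘ.≤-respʳ-≃ (ℚᵘ.≃-sym (toℚᵘ-ι (k t))) (ℚᵘ.*≤* (core n d)))

approximate : ∀ x {e} → 0ℚ ℚ.< e → ∃[ a ] L x a × U x (a ℚ.+ e)
approximate x {e} 0<e =
  walk N a₀ la₀ (U-upper x b₀<end ub₀)
  where
  δ = proj₁ (ℚ.<-dense 0<e)
  0<δ = proj₁ (proj₂ (ℚ.<-dense 0<e))
  δ<e = proj₂ (proj₂ (ℚ.<-dense 0<e))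
  instance
    δ-pos = ℚ.positive 0<δ
    δ-nz = ℚ.pos⇒nonZero δ
  a₀ = proj₁ (L-inhabited x)
  la₀ = proj₂ (L-inhabited x)
  b₀ = proj₁ (U-inhabited x)
  ub₀ = proj₂ (U-inhabited x)
  t = (b₀ ℚ.- a₀) ℚ.* ℚ.1/ δ
  N = proj₁ (archimedean t)
  tδ : t ℚ.* δ ≡ b₀ ℚ.- a₀
  tδ = trans (ℚ.*-assoc (b₀ ℚ.- a₀) (ℚ.1/ δ) δ)
    (trans (cong ((b₀ ℚ.- a₀) ℚ.*_) (ℚ.*-inverseˡ δ)) (ℚ.*-identityʳ _))
  b₀<end : b₀ ℚ.< a₀ ℚ.+ ι N ℚ.* δ
  b₀<end = subst (ℚ._< a₀ ℚ.+ ι N ℚ.* δ)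
    (S.solve 2 (λ a b → a :+ (b :- a) := b) refl a₀ b₀)
    (ℚ.+-monoʳ-< a₀ (subst (ℚ._< ι N ℚ.* δ) tδ (ℚ.*-monoˡ-<-pos δ (proj₂ (archimedean t)))))
  walk : ∀ n a → L x a → U x (a ℚ.+ ι n ℚ.* δ) → ∃[ a ] L x a × U x (a ℚ.+ e)
  walk zero a la ub = contradiction
    (subst (U x) (trans (cong (a ℚ.+_) (ℚ.*-zeroˡ δ)) (ℚ.+-identityʳ a)) ub) (disjoint x la)
  walk (suc n) a la ub with located x (ℚ.+-monoʳ-< a δ<e)
  ... | inj₂ u = a , la , u
  ... | inj₁ l = walk n (a ℚ.+ δ) l (subst (U x)
    (S.solve 3 (λ a d i → a :+ (con 1ℚ :+ i) :* d := (a :+ d) :+ i :* d) refl a δ (ι n)) ub)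

infixl 6 _+_ _-_
infix  8 -_

_+_ : ℝ → ℝ → ℝ
x + y = record
  { L = λ q → ∃[ a ] ∃[ b ] L x a × L y b × q ≡ a ℚ.+ b
  ; U = λ q → ∃[ a ] ∃[ b ] U x a × U y b × q ≡ a ℚ.+ b
  ; L-inhabited = let (a , la) = L-inhabited x ; (b , lb) = L-inhabited y in _ , a , b , la , lb , refl
  ; U-inhabited = let (a , ua) = U-inhabited x ; (b , ub) = U-inhabited y in _ , a , b , ua , ub , refl
  ; L-lower = λ { {p} p<q (a , b , la , lb , refl) →
      a , p ℚ.- a , la , L-lower y (subst (p ℚ.- a ℚ.<_) (cancel a b) (ℚ.+-monoˡ-< (ℚ.- a) p<q)) lb , split p a }
  ; U-upper = λ { {_} {q} p<q (a , b , ua , ub , refl) →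
      a , q ℚ.- a , ua , U-upper y (subst (ℚ._< q ℚ.- a) (cancel a b) (ℚ.+-monoˡ-< (ℚ.- a) p<q)) ub , split q a }
  ; L-open = λ { (a , b , la , lb , refl) → let (c , b<c , lc) = L-open y lb in
      a ℚ.+ c , ℚ.+-monoʳ-< a b<c , a , c , la , lc , refl }
  ; U-open = λ { (a , b , ua , ub , refl) → let (c , c<b , uc) = U-open y ub in
      a ℚ.+ c , ℚ.+-monoʳ-< a c<b , a , c , ua , uc , refl }
  ; disjoint = λ { (a , b , la , lb , refl) (c , d , uc , ud , eq) →
      ℚ.<-irrefl eq (ℚ.+-mono-< (L<U x la uc) (L<U y lb ud)) }
  ; located = loc
  }
  where
  cancel : ∀ a b → a ℚ.+ b ℚ.- a ≡ b
  cancel = S.solve 2 (λ a b → (a :+ b) :- a := b) refl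
  split : ∀ p a → p ≡ a ℚ.+ (p ℚ.- a)
  split = S.solve 2 (λ p a → p := a :+ (p :- a)) refl
  loc : ∀ {p q} → p ℚ.< q → _ ⊎ _
  loc {p} {q} p<q =
    let (m , p<m , m<q) = ℚ.<-dense p<q
        (a , la , ub) = approximate x (0<q-p p<m)
        b = a ℚ.+ (m ℚ.- p)
        gap = subst₂ ℚ._<_
          (S.solve 3 (λ p a m → m :+ (p :- (a :+ m)) := p :- a) refl p a m)
          (S.solve 4 (λ p q a m → q :+ (p :- (a :+ m)) := q :- (a :+ (m :- p))) refl p q a m)
          (ℚ.+-monoˡ-< (p ℚ.- (a ℚ.+ m)) m<q)
    in case-located a b la ub gap
    where
    case-located : ∀ a b → L x a → U x b → p ℚ.- a ℚ.< q ℚ.- b → _ ⊎ _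
    case-located a b la ub gap with located y gap
    ... | inj₁ l = inj₁ (a , p ℚ.- a , la , l , split p a)
    ... | inj₂ u = inj₂ (b , q ℚ.- b , ub , u , split q b)

-_ : ℝ → ℝ
- x = record
  { L = λ q → U x (ℚ.- q)
  ; U = λ q → L x (ℚ.- q)
  ; L-inhabited = let (b , ub) = U-inhabited x in ℚ.- b , subst (U x) (sym (neg-involutive b)) ub
  ; U-inhabited = let (a , la) = L-inhabited x in ℚ.- a , subst (L x) (sym (neg-involutive a)) la
  ; L-lower = λ p<q → U-upper x (ℚ.neg-antimono-< p<q)
  ; U-upper = λ p<q → L-lower x (ℚ.neg-antimono-< p<q)
  ; L-open = λ {p} u → let (c , c<-p , uc) = U-open x u in
      ℚ.- c , subst (ℚ._< ℚ.- c) (neg-involutive p) (ℚ.neg-antimono-< c<-p)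
            , subst (U x) (sym (neg-involutive c)) uc
  ; U-open = λ {q} l → let (c , -q<c , lc) = L-open x l in
      ℚ.- c , subst (ℚ.- c ℚ.<_) (neg-involutive q) (ℚ.neg-antimono-< -q<c)
            , subst (L x) (sym (neg-involutive c)) lc
  ; disjoint = λ u l → disjoint x l u
  ; located = λ p<q → Sum.swap (located x (ℚ.neg-antimono-< p<q))
  }

_-_ : ℝ → ℝ → ℝ
x - y = x + (- y)

sum : List ℝ → ℝ
sum = foldr _+_ (fromℕ 0)

quotient : ∀ {c} s → 0ℚ ℚ.< c → ∃[ r ] r ℚ.* c ≡ s
quotient {c} s 0<c = s ℚ.* ℚ.1/ c ,
  trans (ℚ.*-assoc s (ℚ.1/ c) c) (trans (cong (s ℚ.*_) (ℚ.*-inverseˡ c)) (ℚ.*-identityʳ s))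
  where instance _ = ℚ.pos⇒nonZero c {{ℚ.positive 0<c}}

*-monoˡ : ∀ {c p q} → 0ℚ ℚ.< c → p ℚ.< q → p ℚ.* c ℚ.< q ℚ.* c
*-monoˡ {c} 0<c = ℚ.*-monoˡ-<-pos c {{ℚ.positive 0<c}}

*-monoʳ : ∀ {c p q} → 0ℚ ℚ.< c → p ℚ.< q → c ℚ.* p ℚ.< c ℚ.* q
*-monoʳ {c} 0<c = ℚ.*-monoʳ-<-pos c {{ℚ.positive 0<c}}

*-cancelʳ-< : ∀ p q {c} → 0ℚ ℚ.< c → p ℚ.* c ℚ.< q ℚ.* c → p ℚ.< q
*-cancelʳ-< p q {c} 0<c = ℚ.*-cancelʳ-<-nonNeg c {{ℚ.pos⇒nonNeg c {{ℚ.positive 0<c}}}}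

inverse : (x : ℝ) → fromℕ 0 < x → ℝ
inverse x (z , 0<z , lz) = record
  { L = λ q → ∃[ u ] U x u × q ℚ.* u ℚ.< 1ℚ
  ; U = λ q → ∃[ l ] 0ℚ ℚ.< l × L x l × 1ℚ ℚ.< q ℚ.* l
  ; L-inhabited = let (u , uu) = U-inhabited x in
      0ℚ , u , uu , subst (ℚ._< 1ℚ) (sym (ℚ.*-zeroˡ u)) (ℚ.positive⁻¹ 1ℚ)
  ; U-inhabited = let (r , rz≡2) = quotient (1ℚ ℚ.+ 1ℚ) 0<z in
      r , z , 0<z , lz , subst (1ℚ ℚ.<_) (sym rz≡2) (p<p+1 1ℚ)
  ; L-lower = λ { p<q (u , uu , qu<1) → u , uu , ℚ.<-trans (*-monoˡ (0<U uu) p<q) qu<1 }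
  ; U-upper = λ { p<q (l , 0<l , ll , 1<pl) → l , 0<l , ll , ℚ.<-trans 1<pl (*-monoˡ 0<l p<q) }
  ; L-open = λ { {p} (u , uu , pu<1) →
      let (m , pu<m , m<1) = ℚ.<-dense pu<1
          (r , ru≡m) = quotient m (0<U uu)
      in r , *-cancelʳ-< p r (0<U uu) (subst (p ℚ.* u ℚ.<_) (sym ru≡m) pu<m)
           , u , uu , subst (ℚ._< 1ℚ) (sym ru≡m) m<1 }
  ; U-open = λ { {q} (l , 0<l , ll , 1<ql) →
      let (m , 1<m , m<ql) = ℚ.<-dense 1<ql
          (r , rl≡m) = quotient m 0<l
      in r , *-cancelʳ-< r q 0<l (subst (ℚ._< q ℚ.* l) (sym rl≡m) m<ql)
           , l , 0<l , ll , subst (1ℚ ℚ.<_) (sym rl≡m) 1<m }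
  ; disjoint = λ { {q} (u , uu , qu<1) (l , 0<l , ll , 1<ql) →
      let 0<q = *-cancelʳ-< 0ℚ q 0<l (subst (ℚ._< q ℚ.* l) (sym (ℚ.*-zeroˡ l)) (ℚ.<-trans (ℚ.positive⁻¹ 1ℚ) 1<ql))
      in ℚ.<-asym (ℚ.<-trans qu<1 1<ql) (*-monoʳ 0<q (L<U x ll uu)) }
  ; located = loc
  }
  where
  0<U : ∀ {u} → U x u → 0ℚ ℚ.< u
  0<U uu = ℚ.<-trans 0<z (L<U x lz uu)
  loc : ∀ {p q} → p ℚ.< q → _ ⊎ _
  loc {p} {q} p<q with 0ℚ ℚ.<? p
  ... | no p≯0 = let (u , uu) = U-inhabited x in
    inj₁ (u , uu , ℚ.≤-<-trans
      (subst (p ℚ.* u ℚ.≤_) (ℚ.*-zeroˡ u)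
        (ℚ.*-monoʳ-≤-nonNeg u {{ℚ.pos⇒nonNeg u {{ℚ.positive (0<U uu)}}}} (ℚ.≮⇒≥ p≯0)))
      (ℚ.positive⁻¹ 1ℚ))
  ... | yes 0<p =
    let 0<q = ℚ.<-trans 0<p p<q
        (s , sq≡1) = quotient 1ℚ 0<q
        (t , tp≡1) = quotient 1ℚ 0<p
        0<s = *-cancelʳ-< 0ℚ s 0<q (subst₂ ℚ._<_ (sym (ℚ.*-zeroˡ q)) (sym sq≡1) (ℚ.positive⁻¹ 1ℚ))
        s<t = *-cancelʳ-< s t 0<p (subst (s ℚ.* p ℚ.<_) (trans sq≡1 (sym tp≡1)) (*-monoʳ 0<s p<q))
        (b , s<b , b<t) = ℚ.<-dense s<t
        (a , s<a , a<b) = ℚ.<-dense s<b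
    in case-located
      (λ la → a , ℚ.<-trans 0<s s<a , la
            , subst₂ ℚ._<_ sq≡1 (ℚ.*-comm a q) (*-monoˡ 0<q s<a))
      (λ ub → b , ub , subst₂ ℚ._<_ (ℚ.*-comm b p) tp≡1 (*-monoˡ 0<p b<t))
      (located x a<b)
    where
    case-located : ∀ {A B C D : Set} → (A → D) → (B → C) → A ⊎ B → C ⊎ D
    case-located f g (inj₁ a) = inj₂ (f a)
    case-located f g (inj₂ b) = inj₁ (g b)

-- A rational lies below √m iff it is below some rational with square at most m,
-- and above √m iff it is above some nonnegative rational with square at least m.
√_ : ℕ → ℝ
√ m = record
  { L = λ q → ∃[ r ] q ℚ.< r × r ℚ.* r ℚ.≤ M
  ; U = λ q → ∃[ r ] r ℚ.< q × 0ℚ ℚ.≤ r × M ℚ.≤ r ℚ.* r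
  ; L-inhabited = 0ℚ ℚ.- 1ℚ , 0ℚ , p-1<p 0ℚ , 0≤M
  ; U-inhabited = M ℚ.+ 1ℚ ℚ.+ 1ℚ , M ℚ.+ 1ℚ , p<p+1 (M ℚ.+ 1ℚ) , 0≤M+1 , M≤[M+1]²
  ; L-lower = λ { p<q (r , q<r , h) → r , ℚ.<-trans p<q q<r , h }
  ; U-upper = λ { p<q (r , r<p , h) → r , ℚ.<-trans r<p p<q , h }
  ; L-open = λ { (r , p<r , h) → let (m , p<m , m<r) = ℚ.<-dense p<r in m , p<m , r , m<r , h }
  ; U-open = λ { (r , r<q , h) → let (m , r<m , m<q) = ℚ.<-dense r<q in m , m<q , r , r<m , h }
  ; disjoint = λ { (r , q<r , r²≤M) (s , s<q , 0≤s , M≤s²) →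
      let s<r = ℚ.<-trans s<q q<r in
      ℚ.<-irrefl refl (ℚ.<-≤-trans (square-< 0≤s s<r) (ℚ.≤-trans r²≤M M≤s²)) }
  ; located = loc
  }
  where
  M = ℕ→ℚ m
  0≤M : 0ℚ ℚ.≤ M
  0≤M = ℚ.nonNegative⁻¹ M {{ℚ.normalize-nonNeg m 1}}
  M≤M+1 : M ℚ.≤ M ℚ.+ 1ℚ
  M≤M+1 = ℚ.<⇒≤ (p<p+1 M)
  0≤M+1 : 0ℚ ℚ.≤ M ℚ.+ 1ℚ
  0≤M+1 = ℚ.≤-trans 0≤M M≤M+1
  1≤M+1 : 1ℚ ℚ.≤ M ℚ.+ 1ℚ
  1≤M+1 = subst (ℚ._≤ M ℚ.+ 1ℚ) (ℚ.+-identityˡ 1ℚ) (ℚ.+-monoˡ-≤ 1ℚ 0≤M)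
  M≤[M+1]² : M ℚ.≤ (M ℚ.+ 1ℚ) ℚ.* (M ℚ.+ 1ℚ)
  M≤[M+1]² = ℚ.≤-trans M≤M+1 (subst (ℚ._≤ (M ℚ.+ 1ℚ) ℚ.* (M ℚ.+ 1ℚ)) (ℚ.*-identityˡ _)
    (ℚ.*-monoʳ-≤-nonNeg (M ℚ.+ 1ℚ) {{ℚ.nonNegative 0≤M+1}} 1≤M+1))
  square-< : ∀ {s r} → 0ℚ ℚ.≤ s → s ℚ.< r → s ℚ.* s ℚ.< r ℚ.* r
  square-< {s} {r} 0≤s s<r = ℚ.≤-<-trans
    (ℚ.*-monoˡ-≤-nonNeg s {{ℚ.nonNegative 0≤s}} (ℚ.<⇒≤ s<r))
    (*-monoˡ (ℚ.≤-<-trans 0≤s s<r) s<r)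
  loc : ∀ {p q} → p ℚ.< q → _ ⊎ _
  loc {p} {q} p<q with ℚ.<-dense p<q
  ... | r , p<r , r<q with r ℚ.* r ℚ.≤? M | 0ℚ ℚ.≤? r
  ... | yes r²≤M | _ = inj₁ (r , p<r , r²≤M)
  ... | no r²≰M | yes 0≤r = inj₂ (r , r<q , 0≤r , ℚ.<⇒≤ (ℚ.≰⇒> r²≰M))
  ... | no _ | no 0≰r = inj₁ (0ℚ , ℚ.<-trans p<r (ℚ.≰⇒> 0≰r) , 0≤M)

√-pos : ∀ k → fromℕ 0 < √ (suc k)
√-pos k = let (m , 0<m , m<1) = ℚ.<-dense (ℚ.positive⁻¹ 1ℚ) in
  m , 0<m , 1ℚ , m<1 ,
  ℚ.toℚᵘ-cancel-≤ (ℚᵘ.≤-respʳ-≃ (ℚᵘ.≃-sym (ℚ.toℚᵘ-fromℚᵘ (ℚᵘ.mkℚᵘ (+ suc k) 0)))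
    (ℚᵘ.*≤* (ℤ.+≤+ (ℕ.s≤s ℕ.z≤n))))

-- 1/√0 is set to 0; by ~⇒deg≢0 below this value never enters the Randić index.
1/√_ : ℕ → ℝ
1/√ zero = fromℕ 0
1/√ (suc k) = inverse (√ (suc k)) (√-pos k)

record Graph : Set₁ where
  infix 4 _~_ _~?_
  field
    n        : ℕ
    _~_      : Rel (Fin n) 0ℓ
    _~?_     : Decidable _~_
    ~-sym    : Symmetric _~_
    ~-irrefl : Irreflexive _≡_ _~_

  degree : Fin n → ℕ
  degree i = length (filter (i ~?_) (allFin n))

  -- The edge {i , j} is listed once, as the pair with i < j.
  edges : List (Fin n × Fin n)
  edges = filter (λ (i , j) → (i Fin.<? j) ×-dec (i ~? j)) (cartesianProduct (allFin n) (allFin n))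

  randić : ℝ
  randić = sum (map (λ (i , j) → 1/√ (degree i ℕ.* degree j)) edges)

  Independent : Subset n → Set
  Independent A = ∀ i → i ∈ A → ∀ j → j ∈ A → ¬ (i ~ j)

  independent? : ∀ A → Dec (Independent A)
  independent? A = Fin.all? λ i → (i ∈? A) →-dec Fin.all? λ j → (j ∈? A) →-dec ¬? (i ~? j)

  record Cycle : Set where
    field
      start    : Fin n
      rest     : List (Fin n)
      distinct : Unique (start ∷ rest)
      length≥3 : 3 ℕ.≤ length (start ∷ rest)
      closed   : Linked _~_ (start ∷ rest ∷ʳ start)

  record IsTree : Set where
    field
      nonempty  : NonZero n
      connected : ∀ i j → Star _~_ i j
      acyclic   : ¬ Cycle

  ~⇒deg≢0 : ∀ {i j} → i ~ j → degree i ≢ 0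
  ~⇒deg≢0 {i} {j} i~j = nonempty (∈-filter⁺ (i ~?_) (∈-allFin j) i~j)
    where
    nonempty : ∀ {x : Fin n} {xs} → x List.∈ xs → length xs ≢ 0
    nonempty (here _) ()
    nonempty (there _) ()

subsets : ∀ n → List (Subset n)
subsets zero = [] ∷ []
subsets (suc n) = map (outside ∷_) (subsets n) ++ map (inside ∷_) (subsets n)

∈-subsets : ∀ {n} (A : Subset n) → A List.∈ subsets n
∈-subsets [] = here refl
∈-subsets (false ∷ A) = ∈-++⁺ˡ (∈-map⁺ (outside ∷_) (∈-subsets A))
∈-subsets {suc n} (true ∷ A) = ∈-++⁺ʳ (map (outside ∷_) (subsets n)) (∈-map⁺ (inside ∷_) (∈-subsets A))

module _ (G : Graph) where
  open Graph G

  independenceNumber : ℕ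
  independenceNumber = max 0 (map ∣_∣ (filter independent? (subsets n)))

  independent⇒∣A∣≤α : ∀ A → Independent A → ∣ A ∣ ℕ.≤ independenceNumber
  independent⇒∣A∣≤α A ind = All.lookup (xs≤max 0 (map ∣_∣ (filter independent? (subsets n))))
    (∈-map⁺ ∣_∣ (∈-filter⁺ independent? (∈-subsets A) ind))

  α-attained : ∃[ A ] Independent A × ∣ A ∣ ≡ independenceNumber
  α-attained with argmax-sel (λ k → k) 0 (map ∣_∣ (filter independent? (subsets n)))
  ... | inj₁ α≡0 = Data.Fin.Subset.⊥ , (λ i i∈⊥ → contradiction i∈⊥ ∉⊥) , trans (∣⊥∣≡0 n) (sym α≡0)
  ... | inj₂ α∈ with ∈-map⁻ ∣_∣ α∈
  ... | A , A∈ , α≡∣A∣ = A , proj₂ (∈-filter⁻ independent? {xs = subsets n} A∈) , sym α≡∣A∣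

record Tree : Set₁ where
  field
    graph  : Graph
    isTree : Graph.IsTree graph
  open Graph graph public
  open Graph.IsTree isTree public

s₁₀ : Tree → ℝ
s₁₀ T = randić + fromℕ (independenceNumber graph) - fromℕ n + fromℕ 1 - √ (n ℕ.∸ 1)
  where open Tree T

-- Indices are shifted by one: u zero is the vertex u₁, and w zero is w₁.
data Vertex (b : ℕ) : Set where
  u w : Fin b → Vertex b
  v   : Vertex b

infix 4 _—_ _—?_ _≈_

data _—_ {c : ℕ} : Rel (Vertex (suc c)) 0ℓ where
  u₁uᵢ : ∀ {i} → u zero — u (suc i)
  u₁v  : u zero — v
  vw₁  : v — w zero
  w₁wᵢ : ∀ {i} → w zero — w (suc i)

_—?_ : ∀ {c} → Decidable (_—_ {c})
u zero    —? u zero    = no λ ()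
u zero    —? u (suc _) = yes u₁uᵢ
u (suc _) —? u _       = no λ ()
u zero    —? v         = yes u₁v
u (suc _) —? v         = no λ ()
u _       —? w _       = no λ ()
v         —? u _       = no λ ()
v         —? v         = no λ ()
v         —? w zero    = yes vw₁
v         —? w (suc _) = no λ ()
w _       —? u _       = no λ ()
w _       —? v         = no λ ()
w zero    —? w zero    = no λ ()
w zero    —? w (suc _) = yes w₁wᵢ
w (suc _) —? w _       = no λ ()

_≈_ : ∀ {c} → Rel (Vertex (suc c)) 0ℓ
_≈_ = SymClosure _—_

_≈?_ : ∀ {c} → Decidable (_≈_ {c})
x ≈? y with x —? y | y —? x
... | yes e | _     = yes (fwd e)
... | no _  | yes e = yes (bwd e)
... | no e  | no e′ = no λ { (fwd f) → e f ; (bwd f) → e′ f }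

≈-irrefl : ∀ {c} {x : Vertex (suc c)} → ¬ (x ≈ x)
≈-irrefl (fwd ())
≈-irrefl (bwd ())

vertex′ : ∀ {b} → Fin b ⊎ Fin (suc b) → Vertex b
vertex′ (inj₁ i)       = u i
vertex′ (inj₂ zero)    = v
vertex′ (inj₂ (suc i)) = w i

vertex : ∀ {b} → Fin (b ℕ.+ suc b) → Vertex b
vertex {b} i = vertex′ (splitAt b i)

position : ∀ {b} → Vertex b → Fin (b ℕ.+ suc b)
position {b} (u i) = Fin.join b (suc b) (inj₁ i)
position {b} v     = Fin.join b (suc b) (inj₂ zero)
position {b} (w i) = Fin.join b (suc b) (inj₂ (suc i))

vertex-position : ∀ {b} (x : Vertex b) → vertex (position x) ≡ x
vertex-position {b} (u i) = cong vertex′ (Fin.splitAt-join b (suc b) (inj₁ i))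
vertex-position {b} v     = cong vertex′ (Fin.splitAt-join b (suc b) (inj₂ zero))
vertex-position {b} (w i) = cong vertex′ (Fin.splitAt-join b (suc b) (inj₂ (suc i)))

position-vertex : ∀ {b} (i : Fin (b ℕ.+ suc b)) → position (vertex {b} i) ≡ i
position-vertex {b} i = trans (lemma (splitAt b i)) (Fin.join-splitAt b (suc b) i)
  where
  lemma : ∀ s → position (vertex′ s) ≡ Fin.join b (suc b) s
  lemma (inj₁ _)       = refl
  lemma (inj₂ zero)    = refl
  lemma (inj₂ (suc _)) = refl

T₂-graph : ∀ b → .{{NonZero b}} → Graph
T₂-graph b@(suc _) = record
  { n        = b ℕ.+ suc b
  ; _~_      = _≈_ on vertex {b}
  ; _~?_     = λ i j → vertex i ≈? vertex j
  ; ~-sym    = symmetric _—_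
  ; ~-irrefl = λ { refl → ≈-irrefl }
  }

T₂-isTree : ∀ b → .{{_ : NonZero b}} → Graph.IsTree (T₂-graph b)
T₂-isTree b@(suc c) = record
  { nonempty  = _
  ; connected = λ i j → toV i ◅◅ reverse (λ {i} {j} → Graph.~-sym G {i} {j}) (toV j)
  ; acyclic   = acyclic
  }
  where
  G = T₂-graph b
  open Graph G using (_~_; n; Cycle)

  ≈⇒~ : ∀ {x y} → x ≈ y → position x ~ position y
  ≈⇒~ = subst₂ _≈_ (sym (vertex-position _)) (sym (vertex-position _))

  path : ∀ (x : Vertex b) → Star _~_ (position x) (position {b} v)
  path (u zero)    = ≈⇒~ (fwd u₁v) ◅ ε
  path (u (suc i)) = _◅_ {j = position {b} (u zero)} (≈⇒~ (bwd (u₁uᵢ {i = i}))) (≈⇒~ (fwd u₁v) ◅ ε)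
  path v           = ε
  path (w zero)    = ≈⇒~ (bwd vw₁) ◅ ε
  path (w (suc i)) = _◅_ {j = position {b} (w zero)} (≈⇒~ (bwd (w₁wᵢ {i = i}))) (≈⇒~ (bwd vw₁) ◅ ε)

  toV : ∀ i → Star _~_ i (position {b} v)
  toV i = subst (λ k → Star _~_ k (position {b} v)) (position-vertex {b} i) (path (vertex i))

  data Inner : Vertex b → Set where
    u₁ : Inner (u zero)
    v  : Inner v
    w₁ : Inner (w zero)

  inner : ∀ {x y z} → x ≈ y → y ≈ z → x ≢ z → Inner y
  inner {y = u zero}    _ _ _ = u₁
  inner {y = v}         _ _ _ = v
  inner {y = w zero}    _ _ _ = w₁
  inner {y = u (suc _)} (fwd u₁uᵢ) (bwd u₁uᵢ) x≢z = contradiction refl x≢z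
  inner {y = w (suc _)} (fwd w₁wᵢ) (bwd w₁wᵢ) x≢z = contradiction refl x≢z

  no-triangle : ∀ {x y z} → Inner y → Inner z → x ≈ y → y ≈ z → ¬ (z ≈ x)
  no-triangle u₁ u₁ _ (fwd ()) _
  no-triangle u₁ u₁ _ (bwd ()) _
  no-triangle u₁ v (fwd ()) _ (fwd vw₁)
  no-triangle u₁ v (bwd ()) _ (fwd vw₁)
  no-triangle u₁ v xy _ (bwd u₁v) = ≈-irrefl xy
  no-triangle u₁ w₁ _ (fwd ()) _
  no-triangle u₁ w₁ _ (bwd ()) _
  no-triangle v u₁ (fwd u₁v) _ zx = ≈-irrefl zx
  no-triangle v u₁ (bwd vw₁) _ (fwd ())
  no-triangle v u₁ (bwd vw₁) _ (bwd ())
  no-triangle v v _ yz _ = ≈-irrefl yz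
  no-triangle v w₁ (fwd u₁v) _ (fwd ())
  no-triangle v w₁ (fwd u₁v) _ (bwd ())
  no-triangle v w₁ (bwd vw₁) _ zx = ≈-irrefl zx
  no-triangle w₁ u₁ _ (fwd ()) _
  no-triangle w₁ u₁ _ (bwd ()) _
  no-triangle w₁ v xy _ (fwd vw₁) = ≈-irrefl xy
  no-triangle w₁ v (fwd ()) _ (bwd u₁v)
  no-triangle w₁ v (bwd ()) _ (bwd u₁v)
  no-triangle w₁ w₁ _ yz _ = ≈-irrefl yz

  -- Three consecutive inner vertices of a path are u₁ v w₁ in one of the two orders.
  middle : ∀ {x y z} → Inner x → Inner y → Inner z → x ≈ y → y ≈ z → x ≢ z → y ≡ v
  middle _  v  _  _ _ _ = refl
  middle u₁ u₁ _  xy _ _ = contradiction xy ≈-irrefl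
  middle _  u₁ u₁ _ yz _ = contradiction yz ≈-irrefl
  middle w₁ w₁ _  xy _ _ = contradiction xy ≈-irrefl
  middle _  w₁ w₁ _ yz _ = contradiction yz ≈-irrefl
  middle v  u₁ v  _ _ x≢z = contradiction refl x≢z
  middle v  w₁ v  _ _ x≢z = contradiction refl x≢z
  middle u₁ w₁ _  (fwd ()) _ _
  middle u₁ w₁ _  (bwd ()) _ _
  middle w₁ u₁ _  (fwd ()) _ _
  middle w₁ u₁ _  (bwd ()) _ _
  middle v  u₁ w₁ _ (fwd ()) _
  middle v  u₁ w₁ _ (bwd ()) _
  middle v  w₁ u₁ _ (fwd ()) _
  middle v  w₁ u₁ _ (bwd ()) _

  no-square : ∀ {x₀ x₁ x₂ x₃} → Inner x₁ → Inner x₂ → Inner x₃ →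
              x₀ ≈ x₁ → x₁ ≈ x₂ → x₂ ≈ x₃ → x₁ ≢ x₃ → x₀ ≢ x₂ → ¬ (x₃ ≈ x₀)
  no-square i₁ i₂ i₃ e₀ e₁ e₂ x₁≢x₃ x₀≢x₂ e₃ with middle i₁ i₂ i₃ e₁ e₂ x₁≢x₃
  no-square u₁ i₂ u₁ _ _ _ x₁≢x₃ _ _ | refl = x₁≢x₃ refl
  no-square w₁ i₂ w₁ _ _ _ x₁≢x₃ _ _ | refl = x₁≢x₃ refl
  no-square v i₂ _ _ e₁ _ _ _ _ | refl = ≈-irrefl e₁
  no-square _ i₂ v _ _ e₂ _ _ _ | refl = ≈-irrefl e₂
  no-square u₁ i₂ w₁ (bwd u₁v) _ _ _ x₀≢x₂ _ | refl = x₀≢x₂ refl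
  no-square u₁ i₂ w₁ (bwd u₁uᵢ) _ _ _ _ (fwd ()) | refl
  no-square u₁ i₂ w₁ (bwd u₁uᵢ) _ _ _ _ (bwd ()) | refl
  no-square w₁ i₂ u₁ (fwd vw₁) _ _ _ x₀≢x₂ _ | refl = x₀≢x₂ refl
  no-square w₁ i₂ u₁ (bwd w₁wᵢ) _ _ _ _ (fwd ()) | refl
  no-square w₁ i₂ u₁ (bwd w₁wᵢ) _ _ _ _ (bwd ()) | refl

  ≢-vertex : ∀ {i j : Fin n} → i ≢ j → vertex {b} i ≢ vertex {b} j
  ≢-vertex i≢j eq = i≢j (trans (sym (position-vertex {b} _)) (trans (cong (position {b}) eq) (position-vertex {b} _)))

  -- In a cycle x₀ x₁ … of length at least 5, the successor of x₄
  -- is either a further vertex of the cycle or the starting vertex x₀.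
  inner₄ : ∀ {x₀ x₃ x₄} xs → x₃ ≢ x₀ → All (x₃ ≢_) (x₄ ∷ xs) →
           x₃ ~ x₄ → Linked _~_ (x₄ ∷ xs ∷ʳ x₀) → Inner (vertex x₄)
  inner₄ []      x₃≢x₀ _               e (e′ ∷ _) = inner e e′ (≢-vertex x₃≢x₀)
  inner₄ (_ ∷ _) _     (_ ∷ x₃≢x₅ ∷ _) e (e′ ∷ _) = inner e e′ (≢-vertex x₃≢x₅)

  acyclic : ¬ Cycle
  acyclic record { start = _ ; rest = [] ; length≥3 = ℕ.s≤s () }
  acyclic record { start = _ ; rest = _ ∷ [] ; length≥3 = ℕ.s≤s (ℕ.s≤s ()) }
  acyclic record { start = _ ; rest = _ ∷ _ ∷ []
                 ; distinct = (x₀₁ ∷ x₀₂ ∷ []) ∷ (x₁₂ ∷ []) ∷ _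
                 ; closed = e₀ ∷ e₁ ∷ e₂ ∷ [-] } =
    no-triangle (inner e₀ e₁ (≢-vertex x₀₂)) (inner e₁ e₂ (≢-vertex (x₀₁ ∘ sym))) e₀ e₁ e₂
  acyclic record { start = _ ; rest = _ ∷ _ ∷ _ ∷ []
                 ; distinct = (x₀₁ ∷ x₀₂ ∷ x₀₃ ∷ []) ∷ (x₁₂ ∷ x₁₃ ∷ []) ∷ _
                 ; closed = e₀ ∷ e₁ ∷ e₂ ∷ e₃ ∷ [-] } =
    no-square (inner e₀ e₁ (≢-vertex x₀₂)) (inner e₁ e₂ (≢-vertex x₁₃))
      (inner e₂ e₃ (≢-vertex (x₀₂ ∘ sym))) e₀ e₁ e₂ (≢-vertex x₁₃) (≢-vertex x₀₂) e₃
  acyclic record { start = _ ; rest = _ ∷ _ ∷ _ ∷ _ ∷ xs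
                 ; distinct = (x₀₁ ∷ x₀₂ ∷ x₀₃ ∷ _) ∷ (x₁₂ ∷ x₁₃ ∷ _) ∷ (x₂₃ ∷ x₂₄ ∷ _) ∷ (x₃ ∷ _)
                 ; closed = e₀ ∷ e₁ ∷ e₂ ∷ e₃ ∷ es } =
    ≢-vertex x₂₃ (trans
      (middle i₁ i₂ i₃ e₁ e₂ (≢-vertex x₁₃))
      (sym (middle i₂ i₃ (inner₄ xs (x₀₃ ∘ sym) x₃ e₃ es) e₂ e₃ (≢-vertex x₂₄))))
    where
    i₁ = inner e₀ e₁ (≢-vertex x₀₂)
    i₂ = inner e₁ e₂ (≢-vertex x₁₃)
    i₃ = inner e₂ e₃ (≢-vertex x₂₄)

T₂ : ∀ b → .{{NonZero b}} → Tree
T₂ b = record { graph = T₂-graph b ; isTree = T₂-isTree b }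

{-# OPTIONS --safe #-}

-- Take k with k² < b ≤ (k+1)². The 2(b-1) pendant edges contribute at least
-- 2k²/(k+1) ≥ 2(k-1) to the Randić index, the leaves together with v form an independent
-- set of n-2 vertices, and √(n-1) = √(2b) ≤ (3/2)(k+1). So s₁₀ grows at least like k/2.
module Submission where

open import Defs
open import Data.Nat using (ℕ; NonZero; _≤_)
open import Data.Product using (∃-syntax)
open import Data.Fin as Fin using (Fin; zero; suc; splitAt)
import Data.Fin.Properties as Fin
open import Data.Fin.Subset using (Subset; _∈_; ∣_∣; inside; outside; ⊤)
open import Data.Fin.Subset.Properties using (∣⊤∣≡n)
open import Data.List using (List; []; _∷_; map; filter; length; lookup; allFin)
import Data.List.Membership.Propositional as List
open import Data.List.Membership.Propositional.Properties
  using (∈-filter⁺; ∈-filter⁻; ∈-lookup; ∈-allFin; ∈-cartesianProduct⁺)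
import Data.List.Relation.Unary.All as All
open import Data.List.Relation.Unary.AllPairs using (_∷_)
open import Data.List.Relation.Unary.Any using (index)
open import Data.List.Relation.Unary.Any.Properties using (lookup-index)
open import Data.List.Relation.Unary.Unique.Propositional using (Unique)
import Data.List.Relation.Unary.Unique.Propositional.Properties as Unique
open import Data.Nat as ℕ using (zero; suc; z≤n; s≤s)
import Data.Nat.Properties as ℕ
open import Data.Product using (_×_; _,_; proj₁; proj₂)
open import Data.Rational as ℚ using (ℚ; 0ℚ; 1ℚ; ½)
import Data.Rational.Properties as ℚ
open import Data.Rational.Solver using (module +-*-Solver)
import Data.Rational.Unnormalised.Properties as ℚᵘ
open import Data.Sum using (_⊎_; inj₁; inj₂; [_,_]′)
open import Data.Vec as Vec using (_++_)
import Data.Vec.Properties as Vec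
open import Function using (_∘_; Injective; Injection)
open import Function.Properties.Inverse using (↔⇒↣)
open import Relation.Binary using (tri<; tri≈; tri>)
open import Relation.Binary.PropositionalEquality
  using (_≡_; _≢_; refl; sym; trans; cong; cong₂; subst; subst₂)
open import Relation.Binary.Construct.Closure.Symmetric using (fwd; bwd)
open import Relation.Nullary using (¬_; yes; no; contradiction)
open import Relation.Nullary.Decidable using (_×-dec_)
open import Relation.Unary using (Pred; Decidable)
open import Level using (0ℓ)

open ℝ
open +-*-Solver using (solve; _:+_; _:*_; _:-_; :-_; _:=_; con)

-- Naturals inside the ordered rationals.

ℕ→ℚ≡ι : ∀ m → ℕ→ℚ m ≡ ι m
ℕ→ℚ≡ι m = ℚ.toℚᵘ-injective (ℚᵘ.≃-trans (ℚ.toℚᵘ-fromℚᵘ _) (ℚᵘ.≃-sym (toℚᵘ-ι m)))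

ι-+ : ∀ m n → ι (m ℕ.+ n) ≡ ι m ℚ.+ ι n
ι-+ zero    n = sym (ℚ.+-identityˡ (ι n))
ι-+ (suc m) n = trans (cong (1ℚ ℚ.+_) (ι-+ m n)) (sym (ℚ.+-assoc 1ℚ (ι m) (ι n)))

ι-* : ∀ m n → ι (m ℕ.* n) ≡ ι m ℚ.* ι n
ι-* zero    n = sym (ℚ.*-zeroˡ (ι n))
ι-* (suc m) n = trans (ι-+ n (m ℕ.* n)) (trans (cong (ι n ℚ.+_) (ι-* m n))
  (solve 2 (λ x y → y :+ x :* y := (con 1ℚ :+ x) :* y) refl (ι m) (ι n)))

0≤ι : ∀ m → 0ℚ ℚ.≤ ι m
0≤ι zero    = ℚ.≤-refl
0≤ι (suc m) = ℚ.+-mono-≤ (ℚ.<⇒≤ (ℚ.positive⁻¹ 1ℚ)) (0≤ι m)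

0<ι : ∀ m → 0ℚ ℚ.< ι (suc m)
0<ι m = ℚ.+-mono-<-≤ (ℚ.positive⁻¹ 1ℚ) (0≤ι m)

ι-mono-≤ : ∀ {m n} → m ≤ n → ι m ℚ.≤ ι n
ι-mono-≤ {n = n} z≤n = 0≤ι n
ι-mono-≤ (s≤s m≤n)   = ℚ.+-monoʳ-≤ 1ℚ (ι-mono-≤ m≤n)

0≤+ : ∀ {p q} → 0ℚ ℚ.≤ p → 0ℚ ℚ.≤ q → 0ℚ ℚ.≤ p ℚ.+ q
0≤+ = ℚ.+-mono-≤

0≤* : ∀ {p q} → 0ℚ ℚ.≤ p → 0ℚ ℚ.≤ q → 0ℚ ℚ.≤ p ℚ.* q
0≤* {p} {q} 0≤p 0≤q = ℚ.nonNegative⁻¹ (p ℚ.* q)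
  {{ℚ.nonNeg*nonNeg⇒nonNeg p {{ℚ.nonNegative 0≤p}} q {{ℚ.nonNegative 0≤q}}}}

0≤q-p : ∀ {p q} → p ℚ.≤ q → 0ℚ ℚ.≤ q ℚ.- p
0≤q-p {p} {q} p≤q = subst (ℚ._≤ q ℚ.- p) (ℚ.+-inverseʳ p) (ℚ.+-monoˡ-≤ (ℚ.- p) p≤q)

-- Non-strict rational lower bounds of reals.

-- The negated upper cut is the non-strict order q ≤ x: unlike L, it keeps the endpoints
-- of fromℕ, √ and 1/√ and adds up without approximation.

infix 4 _≼_

_≼_ : ℚ → ℝ → Set
q ≼ x = ¬ U x q

-- Locatedness decides between `L x p` and `U x q`. The margin `p < q` is the price of returning to
-- the lower cut that `_<_` asks for.
≼⇒L : ∀ x {p q} → p ℚ.< q → q ≼ x → L x p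
≼⇒L x p<q q≼x with located x p<q
... | inj₁ l   = l
... | inj₂ uq  = contradiction uq q≼x

≼-weaken : ∀ x {p q} → p ℚ.≤ q → q ≼ x → p ≼ x
≼-weaken x {p} {q} p≤q q≼x up with ℚ.<-cmp p q
... | tri< p<q _ _  = q≼x (U-upper x p<q up)
... | tri≈ _ refl _ = q≼x up
... | tri> _ _ q<p  = ℚ.<-irrefl refl (ℚ.<-≤-trans q<p p≤q)

-- Upper cuts are upward closed, so any `a` in that of `x` exceeds `p` and any `b` in that of `y`
-- exceeds `q`; hence `a + b` is never `p + q`.
+-≼ : ∀ x y {p q} → p ≼ x → q ≼ y → p ℚ.+ q ≼ x + y
+-≼ x y p≼x q≼y (a , b , ua , ub , eq) = ℚ.<-irrefl eq (ℚ.+-mono-<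
  (ℚ.≰⇒> λ a≤p → ≼-weaken x a≤p p≼x ua) (ℚ.≰⇒> λ b≤q → ≼-weaken y b≤q q≼y ub))

fromℕ-≼ : ∀ m → ι m ≼ fromℕ m
fromℕ-≼ m m<m = ℚ.<-irrefl (ℕ→ℚ≡ι m) m<m

neg-fromℕ-≼ : ∀ m → ℚ.- ι m ≼ - fromℕ m
neg-fromℕ-≼ m m<m = ℚ.<-irrefl (trans (neg-involutive (ι m)) (sym (ℕ→ℚ≡ι m))) m<m

U-√ : ∀ {m q r} → 0ℚ ℚ.≤ r → ι m ℚ.≤ r ℚ.* r → r ℚ.< q → U (√ m) q
U-√ {m} {r = r} 0≤r m≤r² r<q = r , r<q , 0≤r , subst (ℚ._≤ r ℚ.* r) (sym (ℕ→ℚ≡ι m)) m≤r²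

-- The lower cut of `√ m` is open: if it contained `r`, it would contain some `q > r`, which
-- `m ≤ r²` places in the upper cut.
neg-√-≼ : ∀ {m r} → 0ℚ ℚ.≤ r → ι m ℚ.≤ r ℚ.* r → ℚ.- r ≼ - (√ m)
neg-√-≼ {m} {r} 0≤r m≤r² l =
  let (_ , r<q , lq) = L-open (√ m) (subst (L (√ m)) (neg-involutive r) l)
  in disjoint (√ m) lq (U-√ {m} 0≤r m≤r² r<q)

0≼1/√ : ∀ m → 0ℚ ≼ 1/√ m
0≼1/√ zero    0<0 = ℚ.<-irrefl refl 0<0
0≼1/√ (suc m) (l , _ , _ , 1<0*l) =
  ℚ.<-asym (ℚ.positive⁻¹ 1ℚ) (subst (1ℚ ℚ.<_) (ℚ.*-zeroˡ l) 1<0*l)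

-- Here `r` is 1/K. A witness `l` below `√ m` with `1 < r * l` would exceed `K`, while `m ≤ K²` puts
-- everything above `K` in the upper cut. The default `1/√ 0 = 0` is why `m ≢ 0` is assumed.
≼1/√ : ∀ {m K r} → m ≢ 0 → m ≤ K ℕ.* K → 0ℚ ℚ.≤ r → r ℚ.* ι K ≡ 1ℚ → r ≼ 1/√ m
≼1/√ {zero} m≢0 _ _ _ _ = m≢0 refl
≼1/√ {m@(suc _)} {K} {r} _ m≤K² 0≤r rK≡1 (l , _ , ll , 1<rl) =
  disjoint (√ m) ll (U-√ {m} (0≤ι K) (subst (ι m ℚ.≤_) (ι-* K K) (ι-mono-≤ m≤K²)) K<l)
  where
  K<l : ι K ℚ.< l
  K<l = ℚ.*-cancelˡ-<-nonNeg r {{ℚ.nonNegative 0≤r}} (subst (ℚ._< r ℚ.* l) (sym rK≡1) 1<rl)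

-- Terms outside `P` are estimated by 0, so only the favourable ones have to be counted.
sum-≼ : ∀ {A : Set} {P : Pred A 0ℓ} (P? : Decidable P) (f : A → ℝ) {r} →
        (∀ a → 0ℚ ≼ f a) → (∀ a → P a → r ≼ f a) →
        ∀ as → ι (length (filter P? as)) ℚ.* r ≼ sum (map f as)
sum-≼ P? f {r} 0≼f r≼f [] = subst (_≼ fromℕ 0) (sym (ℚ.*-zeroˡ r)) (fromℕ-≼ 0)
sum-≼ P? f {r} 0≼f r≼f (a ∷ as) with P? a
... | yes pa = subst (_≼ f a + sum (map f as))
  (solve 2 (λ r i → r :+ i :* r := (con 1ℚ :+ i) :* r) refl r (ι (length (filter P? as))))
  (+-≼ (f a) (sum (map f as)) (r≼f a pa) (sum-≼ P? f 0≼f r≼f as))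
... | no _   = subst (_≼ f a + sum (map f as)) (ℚ.+-identityˡ _)
  (+-≼ (f a) (sum (map f as)) (0≼f a) (sum-≼ P? f 0≼f r≼f as))

-- Counting list entries by injections.

Unique⇒lookup-injective : ∀ {A : Set} {as : List A} → Unique as → Injective _≡_ _≡_ (lookup as)
Unique⇒lookup-injective {as = _ ∷ _} _ {zero} {zero} _ = refl
Unique⇒lookup-injective {as = _ ∷ _} (a∉ ∷ _) {zero} {suc j} eq =
  contradiction eq (All.lookup a∉ (∈-lookup j))
Unique⇒lookup-injective {as = _ ∷ _} (a∉ ∷ _) {suc i} {zero} eq =
  contradiction (sym eq) (All.lookup a∉ (∈-lookup i))
Unique⇒lookup-injective {as = _ ∷ _} (_ ∷ as!) {suc i} {suc j} eq =
  cong suc (Unique⇒lookup-injective as! eq)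

-- Pigeonhole on positions in the list; this gives upper bounds on degrees.
Unique⇒length≤ : ∀ {A : Set} {as : List A} {m} (f : A → Fin m) → Unique as →
                 (∀ {a b} → a List.∈ as → b List.∈ as → f a ≡ f b → a ≡ b) → length as ≤ m
Unique⇒length≤ f as! f-inj = Fin.injective⇒≤ λ {i} {j} eq →
  Unique⇒lookup-injective as! (f-inj (∈-lookup i) (∈-lookup j) eq)

-- Equal membership indices force equal entries; this gives lower bounds on the number of edges.
injection⇒≤length : ∀ {A : Set} {as : List A} {m} (f : Fin m → A) → Injective _≡_ _≡_ f →
                    (∀ i → f i List.∈ as) → m ≤ length as
injection⇒≤length {as = as} f f-inj f∈ = Fin.injective⇒≤ {f = index ∘ f∈} λ {i} {j} eq →
  f-inj (trans (lookup-index (f∈ i)) (trans (cong (lookup as) eq) (sym (lookup-index (f∈ j)))))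

-- Degrees and the Randić index of a graph.

module _ (G : Graph) where
  open Graph G

  degree≤ : ∀ {m} i (f : Fin n → Fin m) → (∀ {j k} → i ~ j → i ~ k → f j ≡ f k → j ≡ k) → degree i ≤ m
  degree≤ i f f-inj = Unique⇒length≤ f (Unique.filter⁺ (i ~?_) (Unique.allFin⁺ n)) λ j∈ k∈ →
    f-inj (neighbour j∈) (neighbour k∈)
    where
    neighbour : ∀ {j} → j List.∈ filter (i ~?_) (allFin n) → i ~ j
    neighbour j∈ = proj₂ (∈-filter⁻ (i ~?_) {xs = allFin n} j∈)

  ∈-edges : ∀ {i j} → i Fin.< j → i ~ j → (i , j) List.∈ edges
  ∈-edges {i} {j} i<j i~j = ∈-filter⁺ (λ (i , j) → (i Fin.<? j) ×-dec (i ~? j))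
    (∈-cartesianProduct⁺ (∈-allFin i) (∈-allFin j)) (i<j , i~j)

  -- Each listed edge contributes at least 1/K, and all others at least 0.
  randić-≼ : ∀ {m K r} (e : Fin m → Fin n × Fin n) → Injective _≡_ _≡_ e →
             (∀ t → let (i , j) = e t in i Fin.< j × i ~ j × degree i ℕ.* degree j ≤ K ℕ.* K) →
             0ℚ ℚ.≤ r → r ℚ.* ι K ≡ 1ℚ → ι m ℚ.* r ≼ randić
  randić-≼ {m} {K} {r} e e-inj e-edge 0≤r rK≡1 = ≼-weaken randić
    (ℚ.*-monoʳ-≤-nonNeg r {{ℚ.nonNegative 0≤r}} (ι-mono-≤ m≤))
    (sum-≼ light? (λ x → 1/√ (weight x)) (λ x → 0≼1/√ (weight x))
      (λ x (x≢0 , x≤K²) → ≼1/√ {weight x} {K} (ℕ.m<n⇒n≢0 x≢0) x≤K² 0≤r rK≡1) edges)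
    where
    weight : Fin n × Fin n → ℕ
    weight (i , j) = degree i ℕ.* degree j
    light? : Decidable (λ x → 0 ℕ.< weight x × weight x ≤ K ℕ.* K)
    light? x = (0 ℕ.<? weight x) ×-dec (weight x ℕ.≤? K ℕ.* K)
    -- Only an inequality: other edges may also be light.
    m≤ : m ≤ length (filter light? edges)
    m≤ = injection⇒≤length e e-inj λ t → let (i<j , i~j , w≤K²) = e-edge t in
      ∈-filter⁺ light? (∈-edges i<j i~j)
        (ℕ.*-mono-≤ (ℕ.n≢0⇒n>0 (~⇒deg≢0 i~j)) (ℕ.n≢0⇒n>0 (~⇒deg≢0 (~-sym i~j))) , w≤K²)

∣++∣ : ∀ {m n} (p : Subset m) (q : Subset n) → ∣ p ++ q ∣ ≡ ∣ p ∣ ℕ.+ ∣ q ∣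
∣++∣ Vec.[] q = refl
∣++∣ (inside  Vec.∷ p) q = cong suc (∣++∣ p q)
∣++∣ (outside Vec.∷ p) q = ∣++∣ p q

-- Pendant edges and an independent set of T(2,b).

module _ (c : ℕ) where
  private
    b = suc c
    G = T₂-graph b
  open Graph G

  pos : Vertex b → Fin n
  pos = position

  pos-injective : Injective _≡_ _≡_ pos
  pos-injective {x} {y} eq = trans (sym (vertex-position x)) (trans (cong (vertex {b}) eq) (vertex-position y))

  vertex-injective : Injective _≡_ _≡_ (vertex {b})
  vertex-injective {i} {j} eq =
    trans (sym (position-vertex {b} i)) (trans (cong pos eq) (position-vertex {b} j))

  ≈⇒~ : ∀ {x y} → x ≈ y → pos x ~ pos y
  ≈⇒~ = subst₂ _≈_ (sym (vertex-position _)) (sym (vertex-position _))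

  T₂-degree≤ : ∀ {m} x (f : Vertex b → Fin m) →
               (∀ {y z} → x ≈ y → x ≈ z → f y ≡ f z → y ≡ z) → degree (pos x) ≤ m
  T₂-degree≤ x f f-inj = degree≤ G (pos x) (f ∘ vertex) λ e e′ eq →
    vertex-injective (f-inj (subst (_≈ _) (vertex-position x) e) (subst (_≈ _) (vertex-position x) e′) eq)

  center leaf : Fin c ⊎ Fin c → Vertex b
  center (inj₁ _) = u zero
  center (inj₂ _) = w zero
  leaf (inj₁ i) = u (suc i)
  leaf (inj₂ i) = w (suc i)

  leaf-injective : Injective _≡_ _≡_ leaf
  leaf-injective {inj₁ _} {inj₁ _} refl = refl
  leaf-injective {inj₂ _} {inj₂ _} refl = refl

  center≈leaf : ∀ s → center s ≈ leaf s
  center≈leaf (inj₁ _) = fwd u₁uᵢ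
  center≈leaf (inj₂ _) = fwd w₁wᵢ

  -- `edges` keeps only the orientation with the smaller index first.
  center<leaf : ∀ s → pos (center s) Fin.< pos (leaf s)
  center<leaf (inj₁ i) = s≤s z≤n
  center<leaf (inj₂ i) = subst₂ ℕ._<_
    (sym (Fin.toℕ-↑ʳ b (suc zero))) (sym (Fin.toℕ-↑ʳ b (suc (suc i))))
    (ℕ.+-monoʳ-< b (s≤s (s≤s z≤n)))

  -- Meant to be injective only on the neighbours of one center: `v` takes the value `zero`, free
  -- there because a center is not its own neighbour.
  branch : Vertex b → Fin b
  branch (u i) = i
  branch v     = zero
  branch (w i) = i

  degree-center≤ : ∀ s → degree (pos (center s)) ≤ b
  degree-center≤ s = T₂-degree≤ (center s) branch (branch-injective s)
    where
    branch-injective : ∀ s {y z} → center s ≈ y → center s ≈ z → branch y ≡ branch z → y ≡ z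
    branch-injective (inj₁ _) (fwd u₁uᵢ) (fwd u₁uᵢ) refl = refl
    branch-injective (inj₁ _) (fwd u₁v)  (fwd u₁v)  _    = refl
    branch-injective (inj₂ _) (fwd w₁wᵢ) (fwd w₁wᵢ) refl = refl
    branch-injective (inj₂ _) (fwd w₁wᵢ) (bwd vw₁)  ()
    branch-injective (inj₂ _) (bwd vw₁)  (fwd w₁wᵢ) ()
    branch-injective (inj₂ _) (bwd vw₁)  (bwd vw₁)  _    = refl

  degree-leaf≤1 : ∀ s → degree (pos (leaf s)) ≤ 1
  degree-leaf≤1 s = T₂-degree≤ {1} (leaf s) (λ _ → zero) λ e e′ _ → only s e e′
    where
    only : ∀ s {y z} → leaf s ≈ y → leaf s ≈ z → y ≡ z
    only (inj₁ _) (bwd u₁uᵢ) (bwd u₁uᵢ) = refl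
    only (inj₂ _) (bwd w₁wᵢ) (bwd w₁wᵢ) = refl

  T₂-randić-≼ : ∀ {K r} → b ≤ K ℕ.* K → 0ℚ ℚ.≤ r → r ℚ.* ι K ≡ 1ℚ → ι (c ℕ.+ c) ℚ.* r ≼ randić
  T₂-randić-≼ {K} b≤K² = randić-≼ G {K = K} (pendant ∘ splitAt c)
    (λ eq → Injection.injective (↔⇒↣ (Fin.+↔⊎ {c} {c})) (leaf-injective (pos-injective (cong proj₂ eq))))
    (λ t → let s = splitAt c t in
      center<leaf s , ≈⇒~ (center≈leaf s) ,
      ℕ.≤-trans (ℕ.*-mono-≤ (degree-center≤ s) (degree-leaf≤1 s))
        (ℕ.≤-trans (ℕ.≤-reflexive (ℕ.*-identityʳ b)) b≤K²))
    where
    pendant : Fin c ⊎ Fin c → Fin n × Fin n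
    pendant s = pos (center s) , pos (leaf s)

  u-leaves : Subset b
  u-leaves = outside Vec.∷ ⊤

  v∪w-leaves : Subset (suc b)
  v∪w-leaves = inside Vec.∷ outside Vec.∷ ⊤

  leaves∪v : Subset n
  leaves∪v = u-leaves ++ v∪w-leaves

  data Outer : Vertex b → Set where
    uᵢ : ∀ {i} → Outer (u (suc i))
    v  : Outer v
    wᵢ : ∀ {i} → Outer (w (suc i))

  ∈⇒Outer : ∀ i → i ∈ leaves∪v → Outer (vertex {b} i)
  ∈⇒Outer i i∈ = outer (splitAt b i)
    (trans (sym (Vec.lookup-splitAt b u-leaves v∪w-leaves i)) (Vec.[]=⇒lookup i∈))
    where
    -- The centers `u zero` and `w zero` are ruled out by `outside ≡ inside`.
    outer : ∀ s → [ Vec.lookup u-leaves , Vec.lookup v∪w-leaves ]′ s ≡ inside → Outer (vertex′ s)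
    outer (inj₁ (suc _)) _ = uᵢ
    outer (inj₂ zero) _ = v
    outer (inj₂ (suc (suc _))) _ = wᵢ

  ¬Outer≈Outer : ∀ {x y} → Outer x → Outer y → ¬ (x ≈ y)
  ¬Outer≈Outer uᵢ uᵢ (fwd ())
  ¬Outer≈Outer uᵢ uᵢ (bwd ())
  ¬Outer≈Outer uᵢ v  (fwd ())
  ¬Outer≈Outer uᵢ v  (bwd ())
  ¬Outer≈Outer uᵢ wᵢ (fwd ())
  ¬Outer≈Outer uᵢ wᵢ (bwd ())
  ¬Outer≈Outer v  uᵢ (fwd ())
  ¬Outer≈Outer v  uᵢ (bwd ())
  ¬Outer≈Outer v  v  (fwd ())
  ¬Outer≈Outer v  v  (bwd ())
  ¬Outer≈Outer v  wᵢ (fwd ())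
  ¬Outer≈Outer v  wᵢ (bwd ())
  ¬Outer≈Outer wᵢ uᵢ (fwd ())
  ¬Outer≈Outer wᵢ uᵢ (bwd ())
  ¬Outer≈Outer wᵢ v  (fwd ())
  ¬Outer≈Outer wᵢ v  (bwd ())
  ¬Outer≈Outer wᵢ wᵢ (fwd ())
  ¬Outer≈Outer wᵢ wᵢ (bwd ())

  -- The `c` leaves on each side and `v`: `n - 2` vertices.
  T₂-α≥ : c ℕ.+ suc c ≤ independenceNumber G
  T₂-α≥ = subst (_≤ independenceNumber G)
    (trans (∣++∣ u-leaves v∪w-leaves)
      (cong₂ (λ m n → m ℕ.+ suc n) (∣⊤∣≡n c) (∣⊤∣≡n c)))
    (independent⇒∣A∣≤α G leaves∪v λ i i∈ j j∈ → ¬Outer≈Outer (∈⇒Outer i i∈) (∈⇒Outer j j∈))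

-- Numerical estimates.

-- Induction computing the integer square root of `c`: `k` moves up exactly when `suc c` reaches the
-- next square.
consecutive-squares : ∀ c → ∃[ k ] k ℕ.* k ≤ c × suc c ≤ suc k ℕ.* suc k
consecutive-squares zero = 0 , z≤n , ℕ.≤-refl
consecutive-squares (suc c) with consecutive-squares c
... | k , k²≤c , c<[k+1]² with suc (suc c) ℕ.≤? suc k ℕ.* suc k
... | yes h = k , ℕ.m≤n⇒m≤1+n k²≤c , h
... | no  h = suc k , ℕ.≤-pred (ℕ.≰⇒> h) ,
  ℕ.≤-<-trans c<[k+1]² (ℕ.*-mono-< (ℕ.n<1+n (suc k)) (ℕ.n<1+n (suc k)))

3/2ℚ : ℚ
3/2ℚ = 1ℚ ℚ.+ ½

-- 3/2 serves as a rational upper bound for √2: its square exceeds 2 by 1/4.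
2b≤[3K/2]² : ∀ {b K} → b ≤ K ℕ.* K → ι (b ℕ.+ b) ℚ.≤ 3/2ℚ ℚ.* ι K ℚ.* (3/2ℚ ℚ.* ι K)
2b≤[3K/2]² {b} {K} b≤K² = ℚ.≤-trans
  (subst₂ ℚ._≤_ (sym (ι-+ b b)) (cong₂ ℚ._+_ (ι-* K K) (ι-* K K)) (ℚ.+-mono-≤ b≤ b≤))
  (subst₂ ℚ._≤_ (ℚ.+-identityʳ _)
    (solve 1 (λ k → k :* k :+ k :* k :+ con (½ ℚ.* ½) :* (k :* k)
                 := con 3/2ℚ :* k :* (con 3/2ℚ :* k)) refl (ι K))
    (ℚ.+-monoʳ-≤ (ι K ℚ.* ι K ℚ.+ ι K ℚ.* ι K)
      (0≤* (ℚ.nonNegative⁻¹ (½ ℚ.* ½)) (0≤* (0≤ι K) (0≤ι K)))))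
  where
  b≤ : ι b ℚ.≤ ι (K ℕ.* K)
  b≤ = ι-mono-≤ b≤K²

-- Read `x` as k, `y` as b - 1, `a` as α. The Randić term is at least 2x²r = 2(x - 1 + r), and α - n
-- + 1 is at least -1. After subtracting 3(1 + x)/2, at least x/2 - 9/2 remains, whence the 9.
s₁₀-bound : ∀ {x y r a N} → 0ℚ ℚ.≤ r → r ℚ.* (1ℚ ℚ.+ x) ≡ 1ℚ → x ℚ.* x ℚ.≤ y →
            y ℚ.+ (1ℚ ℚ.+ y) ℚ.≤ a → N ℚ.+ N ℚ.+ ι 9 ℚ.≤ x →
            N ℚ.≤ (y ℚ.+ y) ℚ.* r ℚ.+ a ℚ.+ ℚ.- ((1ℚ ℚ.+ y) ℚ.+ (1ℚ ℚ.+ (1ℚ ℚ.+ y))) ℚ.+ 1ℚ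
                    ℚ.+ ℚ.- (3/2ℚ ℚ.* (1ℚ ℚ.+ x))
s₁₀-bound {x} {y} {r} {a} {N} 0≤r r[1+x]≡1 x²≤y 2y+1≤a 2N+9≤x =
  subst₂ ℚ._≤_ (ℚ.+-identityʳ N) (sym decomposition) (ℚ.+-monoʳ-≤ N 0≤gap)
  where
  2r = r ℚ.+ r
  -- A nonnegative combination of the slacks in the hypotheses, plus `2r`.
  gap = (y ℚ.- x ℚ.* x) ℚ.* 2r ℚ.+ (a ℚ.- (y ℚ.+ (1ℚ ℚ.+ y)))
          ℚ.+ 2r ℚ.+ ½ ℚ.* (x ℚ.- (N ℚ.+ N ℚ.+ ι 9))
  0≤2r = 0≤+ 0≤r 0≤r
  0≤gap : 0ℚ ℚ.≤ gap
  0≤gap = 0≤+ (0≤+ (0≤+ (0≤* (0≤q-p x²≤y) 0≤2r) (0≤q-p 2y+1≤a)) 0≤2r)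
    (0≤* (ℚ.nonNegative⁻¹ ½) (0≤q-p 2N+9≤x))
  -- The extra summand 2(x-1)(r(1+x)-1) vanishes; it trades x²r for x-1+r.
  decomposition : _ ≡ N ℚ.+ gap
  decomposition = trans
    (solve 5 (λ x y r a N →
      (y :+ y) :* r :+ a :+ (:- ((con 1ℚ :+ y) :+ (con 1ℚ :+ (con 1ℚ :+ y)))) :+ con 1ℚ
        :+ (:- (con 3/2ℚ :* (con 1ℚ :+ x)))
      := N :+ ((y :- x :* x) :* (r :+ r) :+ (a :- (y :+ (con 1ℚ :+ y)))
          :+ (r :+ r) :+ con ½ :* (x :- (N :+ N :+ con (ι 9))))
        :+ (x :+ x :- con (ι 2)) :* (r :* (con 1ℚ :+ x) :- con 1ℚ)) refl x y r a N)
    (trans (cong (λ z → N ℚ.+ gap ℚ.+ (x ℚ.+ x ℚ.- ι 2) ℚ.* (z ℚ.- 1ℚ)) r[1+x]≡1)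
      (solve 2 (λ g x → g :+ (x :+ x :- con (ι 2)) :* (con 1ℚ :- con 1ℚ) := g) refl (N ℚ.+ gap) x))

-- Divergence of s₁₀ on T(2,b).

theorem4 : (M : ℝ) → ∃[ B ] ((b : ℕ) .{{_ : NonZero b}} → B ≤ b → M < s₁₀ (T₂ b))
theorem4 M = suc K₀ ℕ.* suc K₀ , bound
  where
  m = proj₁ (U-inhabited M)
  N = proj₁ (archimedean m)
  -- The least `k` that `s₁₀-bound` accepts for the target `N`.
  K₀ = N ℕ.+ N ℕ.+ 9
  bound : (b : ℕ) .{{_ : NonZero b}} → suc K₀ ℕ.* suc K₀ ≤ b → M < s₁₀ (T₂ b)
  bound b@(suc c) K₀²≤b =
    m , proj₂ (U-inhabited M) , ≼⇒L (s₁₀ (T₂ b)) (ℚ.<-≤-trans (proj₂ (archimedean m)) N≤q) q≼s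
    where
    open Graph (T₂-graph b)
    α = independenceNumber (T₂-graph b)
    k = proj₁ (consecutive-squares c)
    k²≤c = proj₁ (proj₂ (consecutive-squares c))
    b≤K² = proj₂ (proj₂ (consecutive-squares c))
    K = suc k
    r = proj₁ (quotient 1ℚ (0<ι k))
    rK≡1 : r ℚ.* ι K ≡ 1ℚ
    rK≡1 = proj₂ (quotient 1ℚ (0<ι k))
    0≤r : 0ℚ ℚ.≤ r
    0≤r = ℚ.<⇒≤ (*-cancelʳ-< 0ℚ r (0<ι k)
      (subst₂ ℚ._<_ (sym (ℚ.*-zeroˡ (ι K))) (sym rK≡1) (ℚ.positive⁻¹ 1ℚ)))
    K₀≤k : K₀ ≤ k
    -- Otherwise b ≤ (k+1)² < (K₀+1)² ≤ b.
    K₀≤k = ℕ.≮⇒≥ λ k<K₀ → ℕ.<⇒≱ (ℕ.*-mono-< (s≤s k<K₀) (s≤s k<K₀)) (ℕ.≤-trans K₀²≤b b≤K²)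
    2N+9≤k : ι N ℚ.+ ι N ℚ.+ ι 9 ℚ.≤ ι k
    2N+9≤k = subst (ℚ._≤ ι k) (trans (ι-+ (N ℕ.+ N) 9) (cong (ℚ._+ ι 9) (ι-+ N N))) (ι-mono-≤ K₀≤k)
    q = ι (c ℕ.+ c) ℚ.* r ℚ.+ ι α ℚ.+ ℚ.- ι n ℚ.+ ι 1 ℚ.+ ℚ.- (3/2ℚ ℚ.* ι K)
    q≼s : q ≼ s₁₀ (T₂ b)
    q≼s =
      +-≼ (randić + fromℕ α - fromℕ n + fromℕ 1) (- (√ (n ℕ.∸ 1)))
        (+-≼ (randić + fromℕ α - fromℕ n) (fromℕ 1)
          (+-≼ (randić + fromℕ α) (- fromℕ n)
            (+-≼ randić (fromℕ α) (T₂-randić-≼ c {K} b≤K² 0≤r rK≡1) (fromℕ-≼ α))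
            (neg-fromℕ-≼ n))
          (fromℕ-≼ 1))
        (neg-√-≼ {n ℕ.∸ 1} (0≤* (ℚ.nonNegative⁻¹ 3/2ℚ) (0≤ι K))
          -- `n ∸ 1` reduces to `c + suc b`, which equals `b + b`.
          (subst (λ m → ι m ℚ.≤ 3/2ℚ ℚ.* ι K ℚ.* (3/2ℚ ℚ.* ι K)) (sym (ℕ.+-suc c b)) (2b≤[3K/2]² {b} {K} b≤K²)))
    N≤q : ι N ℚ.≤ q
    N≤q = subst (ι N ℚ.≤_)
      (cong₂ (λ s t → s ℚ.* r ℚ.+ ι α ℚ.+ ℚ.- t ℚ.+ 1ℚ ℚ.+ ℚ.- (3/2ℚ ℚ.* ι K))
        (sym (ι-+ c c)) (sym (ι-+ b (suc b))))
      (s₁₀-bound 0≤r rK≡1 (subst (ℚ._≤ ι c) (ι-* k k) (ι-mono-≤ k²≤c))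
        (subst (ℚ._≤ ι α) (ι-+ c b) (ι-mono-≤ (T₂-α≥ c))) 2N+9≤k)
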